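{- Let $d\ge0$ be an integer, let $\mathcal D_d$ be the class of all $d$-degenerate graphs, and let $H$ be a graph. If $H$ is not $d$-degenerate then $\mathrm{ex}(H,\mathcal D_d,n)=0$ for all $n$. If $H$ is $d$-degenerate, then there exist positive real numbers $c_1,c_2$ such that $\mathrm{ex}(H,\mathcal D_d,n)\le c_2n^{\alpha_d(H)}$ for every positive integer $n$ and $\mathrm{ex}(H,\mathcal D_d,n)\ge c_1n^{\alpha_d(H)}$ for all sufficiently large $n$.
   Context: Graphs are finite and simple. A graph is $d$-degenerate if every subgraph has minimum degree at most $d$. $\alpha_d(H)$ is the maximum size of a set of pairwise non-adjacent vertices of $H$ each of degree at most $d$ in $H$. For a class $\mathcal G$ of graphs, $\mathrm{ex}(H,\mathcal G,n)$ is the maximum number of subgraphs isomorphic to $H$ contained in an $n$-vertex graph of $\mathcal G$. -}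

module Defs where

open import Data.Bool using (true; false)
open import Data.Fin using (Fin)
open import Data.Fin.Properties using (all?; any?; _≟_)
open import Data.Fin.Subset using (Subset; _∈_; _∉_; ∣_∣; Nonempty)
open import Data.Fin.Subset.Properties using (_∈?_; nonempty?)
import Data.Integer as ℤ
open import Data.List using (List; []; _∷_; map; filter; length; allFin; cartesianProduct; cartesianProductWith)
open import Data.List.Extrema.Nat using (min; max)
import Data.List.Membership.Propositional as List
open import Data.List.Membership.Propositional.Properties using (∈-cartesianProduct⁺; ∈-cartesianProductWith⁺; ∈-allFin)
open import Data.List.Relation.Unary.All as All using (All; []; _∷_)
open import Data.List.Relation.Unary.AllPairs using ([]; _∷_)
open import Data.List.Relation.Unary.Any as Any using (here; there)
open import Data.List.Relation.Unary.Unique.Propositional using (Unique)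
open import Data.List.Relation.Unary.Unique.Propositional.Properties using (cartesianProduct⁺; cartesianProductWith⁺)
open import Data.Nat using (ℕ; zero; suc; _≤_)
open import Data.Nat.Properties using (_≤?_)
open import Data.Product using (Σ; ∃; _×_; _,_; proj₁; proj₂; uncurry)
open import Data.Rational using (ℚ; _/_)
open import Data.Vec using (Vec; []; _∷_; lookup; tabulate)
open import Data.Vec.Properties using (∷-injective; lookup∘tabulate)
open import Function using (_⇔_; mk⇔; Equivalence)
open import Function.Definitions using (Injective)
open import Relation.Binary.PropositionalEquality using (_≡_; _≢_; refl; sym; trans; cong; subst₂)
open import Relation.Nullary using (Dec; yes; no; ¬_; ¬?; contradiction)
open import Relation.Nullary.Decidable using (map′; _×-dec_; _→-dec_; recompute)
open import Relation.Unary using (Decidable)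

private
  variable
    n h : ℕ
    A B : Set

vectors : List A → (n : ℕ) → List (Vec A n)
vectors xs zero    = [] ∷ []
vectors xs (suc n) = cartesianProductWith _∷_ xs (vectors xs n)

∈-vectors : {xs : List A} → (∀ x → x List.∈ xs) → (v : Vec A n) → v List.∈ vectors xs n
∈-vectors all∈ []      = here refl
∈-vectors all∈ (x ∷ v) = ∈-cartesianProductWith⁺ _∷_ (all∈ x) (∈-vectors all∈ v)

vectors-unique : {xs : List A} → Unique xs → ∀ n → Unique (vectors xs n)
vectors-unique u zero    = [] ∷ []
vectors-unique u (suc n) = cartesianProductWith⁺ _∷_ ∷-injective u (vectors-unique u n)

subsets : (n : ℕ) → List (Subset n)
subsets = vectors (true ∷ false ∷ [])

∈-subsets : (p : Subset n) → p List.∈ subsets n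
∈-subsets = ∈-vectors λ { true → here refl ; false → there (here refl) }

subsets-unique : ∀ n → Unique (subsets n)
subsets-unique = vectors-unique (((λ ()) ∷ []) ∷ [] ∷ [])

module _ {P : A → Set} (P? : Decidable P) (mk : ∀ a → .(P a) → B) where

  refine : List A → List B
  refine []       = []
  refine (a ∷ as) with P? a
  ... | yes p = mk a p ∷ refine as
  ... | no  _ = refine as

  ∈-refine : ∀ {a as} → .(p : P a) → a List.∈ as → mk a p List.∈ refine as
  ∈-refine {a} p (here refl) with P? a
  ... | yes _ = here refl
  ... | no ¬p = contradiction (recompute (P? a) p) ¬p
  ∈-refine {as = b ∷ _} p (there a∈) with P? b
  ... | yes _ = there (∈-refine p a∈)
  ... | no  _ = ∈-refine p a∈

  module _ (base : B → A) (base-mk : ∀ a .(p : P a) → base (mk a p) ≡ a) where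

    refine-fresh : ∀ {a as} .(p : P a) → All (a ≢_) as → All (mk a p ≢_) (refine as)
    refine-fresh p [] = []
    refine-fresh {a} {b ∷ _} p (a≢b ∷ a∉) with P? b
    ... | yes q = (λ eq → a≢b (trans (sym (base-mk a p)) (trans (cong base eq) (base-mk b q)))) ∷ refine-fresh p a∉
    ... | no  _ = refine-fresh p a∉

    refine-unique : ∀ {as} → Unique as → Unique (refine as)
    refine-unique [] = []
    refine-unique {a ∷ _} (a∉ ∷ u) with P? a
    ... | yes p = refine-fresh p a∉ ∷ refine-unique u
    ... | no  _ = refine-unique u

-- Row u of the vector is the neighbourhood of the vertex u.
IsSimple : Vec (Subset n) n → Set
IsSimple N = (∀ u v → v ∈ lookup N u → u ∈ lookup N v) × (∀ u → u ∉ lookup N u)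

isSimple? : Decidable (IsSimple {n})
isSimple? N =
  all? (λ u → all? λ v → (v ∈? lookup N u) →-dec (u ∈? lookup N v))
  ×-dec all? (λ u → ¬? (u ∈? lookup N u))

-- A graph with vertex set Fin n. As the proof is irrelevant, two graphs on
-- Fin n are propositionally equal as soon as they have the same edges.
record Graph (n : ℕ) : Set where
  constructor mkGraph
  field
    neighbourhoods : Vec (Subset n) n
    .simple        : IsSimple neighbourhoods

open Graph public using (neighbourhoods)

isSimple : (G : Graph n) → IsSimple (neighbourhoods G)
isSimple (mkGraph N s) = recompute (isSimple? N) s

neighbours : Graph n → Fin n → Subset n
neighbours G = lookup (neighbourhoods G)

Adj : Graph n → Fin n → Fin n → Set
Adj G u v = v ∈ neighbours G u

adj? : (G : Graph n) → ∀ u v → Dec (Adj G u v)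
adj? G u v = v ∈? neighbours G u

degree : Graph n → Fin n → ℕ
degree G v = ∣ neighbours G v ∣

graphs : (n : ℕ) → List (Graph n)
graphs n = refine isSimple? mkGraph (vectors (subsets n) n)

∈-graphs : (G : Graph n) → G List.∈ graphs n
∈-graphs (mkGraph N s) = ∈-refine isSimple? mkGraph s (∈-vectors ∈-subsets N)

graphs-unique : ∀ n → Unique (graphs n)
graphs-unique n =
  refine-unique isSimple? mkGraph neighbourhoods (λ _ _ → refl) (vectors-unique (subsets-unique n) n)

-- Every edge of F is an edge of G with both ends in V.
IsSubgraph : Graph n → Subset n × Graph n → Set
IsSubgraph G (V , F) = ∀ u v → Adj F u v → Adj G u v × u ∈ V × v ∈ V

isSubgraph? : (G : Graph n) → Decidable (IsSubgraph G)
isSubgraph? G (V , F) =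
  all? λ u → all? λ v → adj? F u v →-dec (adj? G u v ×-dec (u ∈? V) ×-dec (v ∈? V))

-- Not necessarily induced nor spanning. The edge set is stored as a graph on
-- all of Fin n; only the vertices in `vertices` belong to the subgraph.
record Subgraph {n : ℕ} (G : Graph n) : Set where
  constructor mkSubgraph
  field
    vertices-edges : Subset n × Graph n
    .subgraph      : IsSubgraph G vertices-edges

  vertices : Subset n
  vertices = proj₁ vertices-edges

  edges : Graph n
  edges = proj₂ vertices-edges

open Subgraph public using (vertices-edges; vertices; edges)

isSubgraph : {G : Graph n} (K : Subgraph G) → IsSubgraph G (vertices-edges K)
isSubgraph {G = G} (mkSubgraph VF s) = recompute (isSubgraph? G VF) s

subgraphs : (G : Graph n) → List (Subgraph G)
subgraphs {n} G = refine (isSubgraph? G) mkSubgraph (cartesianProduct (subsets n) (graphs n))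

∈-subgraphs : {G : Graph n} (K : Subgraph G) → K List.∈ subgraphs G
∈-subgraphs {G = G} (mkSubgraph (V , F) s) =
  ∈-refine (isSubgraph? G) mkSubgraph s (∈-cartesianProduct⁺ (∈-subsets V) (∈-graphs F))

subgraphs-unique : (G : Graph n) → Unique (subgraphs G)
subgraphs-unique {n} G =
  refine-unique (isSubgraph? G) mkSubgraph vertices-edges (λ _ _ → refl)
    (cartesianProduct⁺ (subsets-unique n) (graphs-unique n))

-- No degree exceeds the default value n, so this is the minimum degree whenever K has a vertex.
minDegree : {G : Graph n} → Subgraph G → ℕ
minDegree {n} K = min n (map (degree (edges K)) (filter (_∈? vertices K) (allFin n)))

-- The graph without vertices has no minimum degree and is exempted.
Degenerate : ℕ → Graph n → Set
Degenerate d G = (K : Subgraph G) → Nonempty (vertices K) → minDegree K ≤ d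

degenerate? : ∀ d → Decidable (Degenerate {n} d)
degenerate? d G =
  map′ (λ ps K → All.lookup ps (∈-subgraphs K)) (λ p → All.universal p (subgraphs G))
    (All.all? (λ K → nonempty? (vertices K) →-dec (minDegree K ≤? d)) (subgraphs G))

IsStable : ℕ → Graph n → Subset n → Set
IsStable d H S =
  (∀ u v → u ∈ S → v ∈ S → ¬ Adj H u v) × (∀ u → u ∈ S → degree H u ≤ d)

isStable? : ∀ d (H : Graph n) → Decidable (IsStable d H)
isStable? d H S =
  all? (λ u → all? λ v → (u ∈? S) →-dec ((v ∈? S) →-dec ¬? (adj? H u v)))
  ×-dec all? (λ u → (u ∈? S) →-dec (degree H u ≤? d))

α : ℕ → Graph n → ℕ
α {n} d H = max 0 (map ∣_∣ (filter (isStable? d H) (subsets n)))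

record IsIso (H : Graph h) {G : Graph n} (K : Subgraph G) (φ : Fin h → Fin n) : Set where
  field
    injective : Injective _≡_ _≡_ φ
    image     : ∀ v → v ∈ vertices K ⇔ (∃ λ u → φ u ≡ v)
    adjacency : ∀ u w → Adj H u w ⇔ Adj (edges K) (φ u) (φ w)

infix 4 _≅_ _≅?_

_≅_ : Graph h → {G : Graph n} → Subgraph G → Set
_≅_ {h} {n} H K = Σ (Fin h → Fin n) (IsIso H K)

_⇔?_ : {P Q : Set} → Dec P → Dec Q → Dec (P ⇔ Q)
P? ⇔? Q? =
  map′ (uncurry mk⇔) (λ e → Equivalence.to e , Equivalence.from e)
    ((P? →-dec Q?) ×-dec (Q? →-dec P?))

isIso? : (H : Graph h) {G : Graph n} (K : Subgraph G) → Decidable (IsIso H K)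
isIso? H K φ =
  map′ (λ (i , m , a) → record { injective = λ {u} {w} → i u w ; image = m ; adjacency = a })
       (λ e → (λ u w → IsIso.injective e {u} {w}) , IsIso.image e , IsIso.adjacency e)
    (all? (λ u → all? λ w → (φ u ≟ φ w) →-dec (u ≟ w))
     ×-dec all? (λ v → (v ∈? vertices K) ⇔? any? λ u → φ u ≟ v)
     ×-dec all? (λ u → all? λ w → adj? H u w ⇔? adj? (edges K) (φ u) (φ w)))

IsIso-ext : {H : Graph h} {G : Graph n} {K : Subgraph G} {φ ψ : Fin h → Fin n} →
            (∀ u → φ u ≡ ψ u) → IsIso H K φ → IsIso H K ψ
IsIso-ext {K = K} eq e = record
  { injective = λ {u} {w} p → injective (trans (eq u) (trans p (sym (eq w))))
  ; image     = λ v → mk⇔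
      (λ v∈ → let (u , p) = Equivalence.to (image v) v∈ in u , trans (sym (eq u)) p)
      (λ (u , p) → Equivalence.from (image v) (u , trans (eq u) p))
  ; adjacency = λ u w → mk⇔
      (λ a → subst₂ (Adj (edges K)) (eq u) (eq w) (Equivalence.to (adjacency u w) a))
      (λ a → Equivalence.from (adjacency u w) (subst₂ (Adj (edges K)) (sym (eq u)) (sym (eq w)) a))
  }
  where open IsIso e

_≅?_ : (H : Graph h) {G : Graph n} (K : Subgraph G) → Dec (H ≅ K)
_≅?_ {h} {n} H K =
  map′ (λ any → let (φ , e) = Any.satisfied any in lookup φ , e)
       (λ (φ , e) → List.lose (∈-vectors ∈-allFin (tabulate φ))
                      (IsIso-ext (λ u → sym (lookup∘tabulate φ u)) e))
    (Any.any? (λ φ → isIso? H K (lookup φ)) (vectors (allFin n) h))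

copies : Graph h → Graph n → ℕ
copies H G = length (filter (H ≅?_) (subgraphs G))

record GraphClass : Set₁ where
  field
    Member  : Graph n → Set
    member? : Decidable (Member {n})

𝒟 : ℕ → GraphClass
𝒟 d = record { Member = Degenerate d ; member? = degenerate? d }

-- Equal to 0 if the class has no member with n vertices.
ex : Graph h → GraphClass → ℕ → ℕ
ex H 𝒢 n = max 0 (map (copies H) (filter (GraphClass.member? 𝒢) (graphs n)))

fromℕ : ℕ → ℚ
fromℕ m = ℤ.+ m / 1

{-# OPTIONS --safe #-}

-- A graph is d-degenerate iff every nonempty vertex set W has a vertex with at most d neighbours in W,
-- so its vertices can be removed one by one, each with at most d neighbours left. An embedding φ of H
-- pulls the removal order back to H. The vertices of H removed before all their neighbours (the
-- sources) are pairwise non-adjacent and of degree at most d, hence at most α in number; any other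
-- vertex u has a neighbour w removed earlier, and φ u is one of the at most d later neighbours of φ w.
-- So φ is determined by the images of the sources, a choice of w for every other u, and labels below
-- d, which leaves at most (1 + h d)^h n^α embeddings. Conversely, replacing each vertex of a largest
-- stable set by q copies keeps H d-degenerate and creates q^α copies of H.
module Submission where

open import Defs
open import Data.Nat using (ℕ; _^_; _≥_)
open import Data.Product using (∃; _×_)
open import Data.Rational using (ℚ; 0ℚ; _*_; _≤_; _<_)
open import Relation.Binary.PropositionalEquality using (_≡_)
open import Relation.Nullary using (¬_)
import Data.Empty as Empty
open import Data.Fin using (Fin; zero; suc; combine; _↑ˡ_)
open import Data.Fin.Properties using (any?; _≟_; injective⇒≤; suc-injective; combine-injective; ↑ˡ-injective)
open import Data.Fin.Subset using (Subset; _∈_; _∉_; _⊆_; _∩_; _-_; ⊤; ⊥; ∣_∣; Nonempty; inside; outside)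
open import Data.Fin.Subset.Properties using (_∈?_; ∈⊤; ∉⊥; ∣⊥∣≡0; drop-there; ⊆-antisym; p⊆q⇒∣p∣≤∣q∣; ∣p∣≤n; ∣p∣≤∣x∷p∣; ∣p∩q∣≤∣p∣; ∩-identityʳ; x∈p∩q⁺; x∈p∩q⁻; x∈p∧x≢y⇒x∈p-y; x∈p⇒∣p-x∣<∣p∣; nonempty?)
import Data.Integer as ℤ
import Data.Integer.Properties as ℤ
open import Data.List as List using (List; []; _∷_; _++_; map; filter; length; allFin; cartesianProduct; cartesianProductWith)
open import Data.List.Extrema.Nat using (argmin-sel; argmax-sel; min≤v⁺; max≤v⁺; xs≤max)
import Data.List.Membership.Propositional as List
open import Data.List.Membership.Propositional.Properties using (∈-lookup; ∈-map⁺; ∈-map⁻; ∈-++⁺ˡ; ∈-++⁺ʳ; ∈-filter⁺; ∈-filter⁻; ∈-allFin; ∈-cartesianProduct⁺; ∈-cartesianProductWith⁺; ∈-cartesianProductWith⁻)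
open import Data.List.Properties using (length-++; length-map; length-tabulate)
open import Data.List.Relation.Unary.All as All using ([])
import Data.List.Relation.Unary.All.Properties as All
open import Data.List.Relation.Unary.AllPairs using ([]; _∷_)
open import Data.List.Relation.Unary.Any using (here; index)
open import Data.List.Relation.Unary.Any.Properties using (lookup-index)
open import Data.List.Relation.Unary.Unique.Propositional using (Unique)
import Data.List.Relation.Unary.Unique.Propositional.Properties as Unique
open import Data.Nat as ℕ using (zero; suc; z≤n; s≤s)
import Data.Nat.DivMod as ℕ
open import Data.Nat.Induction using (<-wellFounded)
import Data.Nat.Properties as ℕ
open import Data.Nat.Solver using (module +-*-Solver)
open import Data.Product using (_,_; proj₁; proj₂)
open import Data.Product.Properties using (,-injective)
open import Data.Rational using (1ℚ; 1/_; toℚᵘ; Positive; NonNegative; NonZero)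
import Data.Rational.Properties as ℚ
open import Data.Rational.Unnormalised as ℚᵘ using (mkℚᵘ; _≃_; *≤*)
import Data.Rational.Unnormalised.Properties as ℚᵘ
open import Data.Sum using (_⊎_; inj₁; inj₂)
open import Data.Sum.Properties using (inj₁-injective; inj₂-injective)
open import Data.Vec using (Vec; []; _∷_; lookup; tabulate; here; there)
open import Data.Vec.Properties using (∷-injective; ∷-injectiveʳ; lookup∘tabulate; tabulate∘lookup; tabulate-cong; []=⇒lookup; lookup⇒[]=)
open import Function using (_∘_; id; mk⇔; Equivalence)
open import Function.Definitions using (Injective)
open import Induction.WellFounded using (Acc; acc)
open import Relation.Binary using (tri<; tri≈; tri>)
open import Relation.Binary.PropositionalEquality using (_≢_; refl; sym; trans; cong; cong₂; subst; subst₂)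
open import Relation.Nullary using (Dec; yes; no; does; contradiction)
open import Relation.Nullary.Decidable using (_×-dec_; _⊎-dec_; ¬?; dec-true)
open import Relation.Unary using (Decidable)

private
  variable
    d h m n : ℕ
    A B : Set

-- Comparing sizes of lists and of subsets

lookup-injective : {xs : List A} → Unique xs → Injective _≡_ _≡_ (List.lookup xs)
lookup-injective (x∉ ∷ u) {zero}  {zero}  _  = refl
lookup-injective (x∉ ∷ u) {zero}  {suc j} eq = contradiction eq (All.lookup x∉ (∈-lookup j))
lookup-injective (x∉ ∷ u) {suc i} {zero}  eq = contradiction (sym eq) (All.lookup x∉ (∈-lookup i))
lookup-injective (x∉ ∷ u) {suc i} {suc j} eq = cong suc (lookup-injective u eq)

-- No `y` is related to two different `x`, so the position of a partner in `ys` determines the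
-- position in `xs`. A relation in place of a function lets a partner rest on a choice, such as that
-- of an isomorphism.
length-≤ : {xs : List A} {ys : List B} (R : A → B → Set) → Unique xs →
           (∀ {x} → x List.∈ xs → ∃ λ y → y List.∈ ys × R x y) →
           (∀ {x x′ y} → R x y → R x′ y → x ≡ x′) →
           length xs ℕ.≤ length ys
length-≤ {xs = xs} {ys} R u total functional = injective⇒≤ position-injective
  where
  partner : ∀ i → ∃ λ y → y List.∈ ys × R (List.lookup xs i) y
  partner i = total (∈-lookup i)

  position : Fin (length xs) → Fin (length ys)
  position i = index (proj₁ (proj₂ (partner i)))

  position-correct : ∀ i → R (List.lookup xs i) (List.lookup ys (position i))
  position-correct i with y , y∈ , r ← partner i = subst (R _) (lookup-index y∈) r

  position-injective : Injective _≡_ _≡_ position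
  position-injective {i} {j} eq = lookup-injective u
    (functional (position-correct i) (subst (R _ ∘ List.lookup ys) (sym eq) (position-correct j)))

∣p∣≤∣q∣-injection : (p : Subset m) (q : Subset n) (f : Fin m → Fin n) →
                    (∀ {u} → u ∈ p → f u ∈ q) →
                    (∀ {u v} → u ∈ p → v ∈ p → f u ≡ f v → u ≡ v) →
                    ∣ p ∣ ℕ.≤ ∣ q ∣
∣p∣≤∣q∣-injection []            q f f∈ inj = z≤n
∣p∣≤∣q∣-injection (outside ∷ p) q f f∈ inj =
  ∣p∣≤∣q∣-injection p q (f ∘ suc) (f∈ ∘ there) λ x y → suc-injective ∘ inj (there x) (there y)
-- Injectivity keeps the other images away from `f zero`, which can therefore be deleted from `q`.
∣p∣≤∣q∣-injection (inside ∷ p)  q f f∈ inj = ℕ.≤-trans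
  (s≤s (∣p∣≤∣q∣-injection p (q - f zero) (f ∘ suc)
    (λ x → x∈p∧x≢y⇒x∈p-y (f∈ (there x)) λ eq → contradiction (inj (there x) here eq) λ ())
    (λ x y → suc-injective ∘ inj (there x) (there y))))
  (x∈p⇒∣p-x∣<∣p∣ (f∈ here))

-- The rank of `u` among the elements of `p`.
label : (p : Subset n) → ∣ p ∣ ℕ.≤ d → ∀ {u} → u ∈ p → Fin d
label (inside  ∷ p) (s≤s le) here      = zero
label (inside  ∷ p) (s≤s le) (there x) = suc (label p le x)
label (outside ∷ p) le       (there x) = label p le x

label-injective : (p : Subset n) (le : ∣ p ∣ ℕ.≤ d) → ∀ {u v} (x : u ∈ p) (y : v ∈ p) →
                  label p le x ≡ label p le y → u ≡ v
label-injective (inside  ∷ p) (s≤s le) here      here      eq = refl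
label-injective (inside  ∷ p) (s≤s le) (there x) (there y) eq =
  cong suc (label-injective p le x y (suc-injective eq))
label-injective (outside ∷ p) le       (there x) (there y) eq = cong suc (label-injective p le x y eq)

-- Subsets and graphs from decidable relations; extensionality

module _ {P : Fin n → Set} (P? : Decidable P) where

  comprehension : Subset n
  comprehension = tabulate (does ∘ P?)

  ∈-comprehension⁺ : ∀ {u} → P u → u ∈ comprehension
  ∈-comprehension⁺ {u} p = lookup⇒[]= u _ (trans (lookup∘tabulate _ u) (dec-true (P? u) p))

  ∈-comprehension⁻ : ∀ {u} → u ∈ comprehension → P u
  ∈-comprehension⁻ {u} u∈ with P? u | trans (sym (lookup∘tabulate (does ∘ P?) u)) ([]=⇒lookup u∈)
  ... | yes p | _  = p

module _ {R : Fin n → Fin n → Set} (R? : ∀ u v → Dec (R u v)) where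

  rows : Vec (Subset n) n
  rows = tabulate (comprehension ∘ R?)

  ∈-rows⁺ : ∀ {u v} → R u v → v ∈ lookup rows u
  ∈-rows⁺ {u} {v} r =
    subst (v ∈_) (sym (lookup∘tabulate (comprehension ∘ R?) u)) (∈-comprehension⁺ (R? u) r)

  ∈-rows⁻ : ∀ {u v} → v ∈ lookup rows u → R u v
  ∈-rows⁻ {u} {v} v∈ = ∈-comprehension⁻ (R? u) (subst (v ∈_) (lookup∘tabulate (comprehension ∘ R?) u) v∈)

  relationGraph : (∀ {u v} → R u v → R v u) → (∀ {u} → ¬ R u u) → Graph n
  relationGraph symmetric irreflexive =
    mkGraph rows ((λ u v → ∈-rows⁺ ∘ symmetric ∘ ∈-rows⁻) , λ u → irreflexive ∘ ∈-rows⁻)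

Adj-sym : (G : Graph n) → ∀ {u v} → Adj G u v → Adj G v u
Adj-sym G = proj₁ (isSimple G) _ _

Adj-irrefl : (G : Graph n) → ∀ {u} → ¬ Adj G u u
Adj-irrefl G = proj₂ (isSimple G) _

graph-ext : {F G : Graph n} → (∀ {u v} → Adj F u v → Adj G u v) → (∀ {u v} → Adj G u v → Adj F u v) → F ≡ G
graph-ext {F = mkGraph M s} {mkGraph N t} F⊆G G⊆F = helper M≡N
  where
  M≡N : M ≡ N
  M≡N = trans (sym (tabulate∘lookup M)) (trans (tabulate-cong (λ u → ⊆-antisym F⊆G G⊆F)) (tabulate∘lookup N))

  helper : ∀ {M N} .{s t} → M ≡ N → mkGraph M s ≡ mkGraph N t
  helper refl = refl

subgraph-ext : {G : Graph n} {K L : Subgraph G} → vertices K ≡ vertices L → edges K ≡ edges L → K ≡ L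
subgraph-ext refl refl = refl

-- The vertices of a copy are the image of its isomorphism, and since its edges end in these
-- vertices, each of them is the image of an edge of `H`. Hence the map alone determines the copy,
-- and counting maps bounds the number of copies.
≅-unique : {H : Graph h} {G : Graph n} {K L : Subgraph G} {φ ψ : Fin h → Fin n} →
           IsIso H K φ → IsIso H L ψ → (∀ u → φ u ≡ ψ u) → K ≡ L
≅-unique {H = H} {G} iso iso′ eq =
  subgraph-ext (⊆-antisym (vertices⊆ iso iso′ eq) (vertices⊆ iso′ iso (sym ∘ eq)))
               (graph-ext (edges⊆ iso iso′ eq) (edges⊆ iso′ iso (sym ∘ eq)))
  where
  module _ {K L : Subgraph G} {φ ψ} (i : IsIso H K φ) (j : IsIso H L ψ) (eq : ∀ u → φ u ≡ ψ u) where

    vertices⊆ : vertices K ⊆ vertices L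
    vertices⊆ {v} v∈ with u , φu≡v ← Equivalence.to (IsIso.image i v) v∈ =
      Equivalence.from (IsIso.image j v) (u , trans (sym (eq u)) φu≡v)

    edges⊆ : ∀ {v w} → Adj (edges K) v w → Adj (edges L) v w
    edges⊆ {v} {w} vw
      with _ , v∈ , w∈ ← isSubgraph K v w vw
      with a , refl ← Equivalence.to (IsIso.image i v) v∈
         | b , refl ← Equivalence.to (IsIso.image i w) w∈ =
      subst₂ (Adj (edges L)) (sym (eq a)) (sym (eq b))
        (Equivalence.to (IsIso.adjacency j a b) (Equivalence.from (IsIso.adjacency i a b) vw))

-- Embeddings and their image subgraphs

record IsEmbedding (H : Graph h) (G : Graph n) (φ : Fin h → Fin n) : Set where
  field
    injective : Injective _≡_ _≡_ φ
    adjacency : ∀ {u v} → Adj H u v → Adj G (φ u) (φ v)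

iso⇒embedding : {H : Graph h} {G : Graph n} {K : Subgraph G} {φ : Fin h → Fin n} →
                IsIso H K φ → IsEmbedding H G φ
iso⇒embedding {K = K} iso = record
  { injective = IsIso.injective iso
  ; adjacency = λ a → proj₁ (isSubgraph K _ _ (Equivalence.to (IsIso.adjacency iso _ _) a))
  }

module _ (H : Graph h) (G : Graph n) {φ : Fin h → Fin n} (emb : IsEmbedding H G φ) where
  open IsEmbedding emb

  private
    ImageEdge : Fin n → Fin n → Set
    ImageEdge v w = ∃ λ a → ∃ λ b → φ a ≡ v × φ b ≡ w × Adj H a b

    image? : ∀ v → Dec (∃ λ u → φ u ≡ v)
    image? v = any? λ u → φ u ≟ v

    imageEdge? : ∀ v w → Dec (ImageEdge v w)
    imageEdge? v w = any? λ a → any? λ b → φ a ≟ v ×-dec φ b ≟ w ×-dec adj? H a b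

    imageEdge-sym : ∀ {v w} → ImageEdge v w → ImageEdge w v
    imageEdge-sym (a , b , p , q , e) = b , a , q , p , Adj-sym H e

    imageEdge-irrefl : ∀ {v} → ¬ ImageEdge v v
    imageEdge-irrefl (a , b , p , q , e) =
      Adj-irrefl H (subst (Adj H a) (injective (trans q (sym p))) e)

    imageEdges : Graph n
    imageEdges = relationGraph imageEdge? imageEdge-sym imageEdge-irrefl

    image-isSubgraph : IsSubgraph G (comprehension image? , imageEdges)
    image-isSubgraph v w vw with a , b , refl , refl , e ← ∈-rows⁻ imageEdge? vw =
      adjacency e , ∈-comprehension⁺ image? (a , refl) , ∈-comprehension⁺ image? (b , refl)

  imageSubgraph : Subgraph G
  imageSubgraph = mkSubgraph (comprehension image? , imageEdges) image-isSubgraph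

  imageSubgraph-iso : IsIso H imageSubgraph φ
  imageSubgraph-iso = record
    { injective = injective
    ; image     = λ v → mk⇔ (∈-comprehension⁻ image?) (∈-comprehension⁺ image?)
    ; adjacency = λ u w → mk⇔
        (λ e → ∈-rows⁺ imageEdge? (u , w , refl , refl , e))
        (λ e → let (a , b , p , q , ab) = ∈-rows⁻ imageEdge? e
               in subst₂ (Adj H) (injective p) (injective q) ab)
    }

-- Degeneracy in terms of vertex sets

SparseVertex : ℕ → Graph n → Subset n → Set
SparseVertex d G W = ∃ λ v → v ∈ W × ∣ neighbours G v ∩ W ∣ ℕ.≤ d

minDegree-attained : {G : Graph n} (K : Subgraph G) → Nonempty (vertices K) → minDegree K ℕ.≤ d →
                     ∃ λ v → v ∈ vertices K × degree (edges K) v ℕ.≤ d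
minDegree-attained {n} K (v , v∈) le
  with argmin-sel id n (map (degree (edges K)) (filter (_∈? vertices K) (allFin n)))
-- If the minimum is the default `n`, then `n` is at most `d`; no degree exceeds `n`, so the given
-- vertex serves.
... | inj₁ ≡n = v , v∈ , ℕ.≤-trans (∣p∣≤n (neighbours (edges K) v)) (subst (ℕ._≤ _) ≡n le)
... | inj₂ attained with w , w∈ , eq ← ∈-map⁻ (degree (edges K)) attained =
  w , proj₂ (∈-filter⁻ (_∈? vertices K) {xs = allFin n} w∈) , subst (ℕ._≤ _) eq le

minDegree-bounded : {G : Graph n} (K : Subgraph G) {v : Fin n} → v ∈ vertices K →
                    degree (edges K) v ℕ.≤ d → minDegree K ℕ.≤ d
minDegree-bounded {n} K {v} v∈ le = min≤v⁺ n _
  (inj₂ (List.lose (∈-map⁺ (degree (edges K)) (∈-filter⁺ (_∈? vertices K) (∈-allFin v) v∈)) le))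

-- Degeneracy is applied to the subgraph induced by `W`, where the degree of a vertex counts its
-- neighbours in `W`.
degenerate⇒sparse : {G : Graph n} → Degenerate d G → ∀ W → Nonempty W → SparseVertex d G W
degenerate⇒sparse {n} {G = G} deg W ne =
  let (v , v∈ , le) = minDegree-attained induced ne (deg induced ne)
  in v , v∈ , ℕ.≤-trans (p⊆q⇒∣p∣≤∣q∣ λ u∈ →
       let (vu , u∈W) = x∈p∩q⁻ (neighbours G v) W u∈ in ∈-rows⁺ edge? (vu , v∈ , u∈W)) le
  where
  Edge : Fin n → Fin n → Set
  Edge u v = Adj G u v × u ∈ W × v ∈ W

  edge? : ∀ u v → Dec (Edge u v)
  edge? u v = adj? G u v ×-dec u ∈? W ×-dec v ∈? W

  induced : Subgraph G
  induced = mkSubgraph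
    (W , relationGraph edge? (λ (uv , u∈ , v∈) → Adj-sym G uv , v∈ , u∈) (Adj-irrefl G ∘ proj₁))
    (λ u v → ∈-rows⁻ edge?)

-- Degrees in any subgraph are at most those in the subgraph induced by its vertices.
sparse⇒degenerate : {G : Graph n} → (∀ W → Nonempty W → SparseVertex d G W) → Degenerate d G
sparse⇒degenerate {G = G} sparse K ne with v , v∈ , le ← sparse (vertices K) ne =
  minDegree-bounded K v∈ (ℕ.≤-trans
    (p⊆q⇒∣p∣≤∣q∣ λ vu → let (e , _ , u∈) = isSubgraph K _ _ vu in x∈p∩q⁺ (e , u∈)) le)

-- A sparse vertex of the image of `W` has the form `f v`, and `f` injects the neighbours of `v` in
-- `W` into those of `f v` in the image. The conditions on `f` are confined to `W` because the
-- projection of a blow-up onto `H` meets them only on part of its vertices.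
sparseVertex-pullback : {H : Graph h} {G : Graph n} → Degenerate d G →
                        (W : Subset h) → Nonempty W → (f : Fin h → Fin n) →
                        (∀ {u v} → u ∈ W → v ∈ W → f u ≡ f v → u ≡ v) →
                        (∀ {u v} → u ∈ W → v ∈ W → Adj H u v → Adj G (f u) (f v)) →
                        SparseVertex d H W
sparseVertex-pullback {H = H} {G} deg W (u , u∈) f inj hom =
  let (x , x∈ , le) = degenerate⇒sparse deg fW (f u , ∈-comprehension⁺ fW? (u , u∈ , refl))
      (v , v∈ , fv≡x) = ∈-comprehension⁻ fW? x∈
  in v , v∈ , ℕ.≤-trans
       (∣p∣≤∣q∣-injection (neighbours H v ∩ W) (neighbours G x ∩ fW) f
         (λ w∈ → let (vw , w∈W) = x∈p∩q⁻ (neighbours H v) W w∈ in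
            x∈p∩q⁺ (subst (λ y → Adj G y _) fv≡x (hom v∈ w∈W vw) , ∈-comprehension⁺ fW? (_ , w∈W , refl)))
         (λ w∈ w′∈ → inj (proj₂ (x∈p∩q⁻ (neighbours H v) W w∈)) (proj₂ (x∈p∩q⁻ (neighbours H v) W w′∈))))
       le
  where
  fW? : ∀ x → Dec (∃ λ u → u ∈ W × f u ≡ x)
  fW? x = any? λ u → u ∈? W ×-dec f u ≟ x

  fW : Subset _
  fW = comprehension fW?

embedding⇒degenerate : {H : Graph h} {G : Graph n} {φ : Fin h → Fin n} →
                       IsEmbedding H G φ → Degenerate d G → Degenerate d H
embedding⇒degenerate {H = H} {φ = φ} emb deg = sparse⇒degenerate λ W ne →
  sparseVertex-pullback {H = H} deg W ne φ (λ _ _ → injective) (λ _ _ → adjacency)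
  where open IsEmbedding emb

-- Bounding `ex`, `α` and `copies`

ex-≤ : (H : Graph h) (b : ℕ) → (∀ {G : Graph n} → Degenerate d G → copies H G ℕ.≤ b) → ex H (𝒟 d) n ℕ.≤ b
ex-≤ {n = n} {d} H b bound = max≤v⁺ z≤n
  (All.map⁺ (All.tabulate (bound ∘ proj₂ ∘ ∈-filter⁻ (degenerate? d) {xs = graphs n})))

copies≤ex : (H : Graph h) {G : Graph n} → Degenerate d G → copies H G ℕ.≤ ex H (𝒟 d) n
copies≤ex {d = d} H {G} deg =
  All.lookup (xs≤max 0 _) (∈-map⁺ (copies H) (∈-filter⁺ (degenerate? d) (∈-graphs G) deg))

stable≤α : {H : Graph h} {S : Subset h} → IsStable d H S → ∣ S ∣ ℕ.≤ α d H
stable≤α {d = d} {H} {S} stable =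
  All.lookup (xs≤max 0 _) (∈-map⁺ ∣_∣ (∈-filter⁺ (isStable? d H) (∈-subsets S) stable))

α-attained : (H : Graph h) → ∃ λ S → IsStable d H S × ∣ S ∣ ≡ α d H
α-attained {h} {d} H with argmax-sel id 0 (map ∣_∣ (filter (isStable? d H) (subsets h)))
-- The default value 0 is the size of the empty stable set.
... | inj₁ ≡0 = ⊥ , ((λ _ _ u∈ → contradiction u∈ ∉⊥) , λ _ u∈ → contradiction u∈ ∉⊥) , trans (∣⊥∣≡0 h) (sym ≡0)
... | inj₂ attained with S , S∈ , eq ← ∈-map⁻ ∣_∣ attained =
  S , proj₂ (∈-filter⁻ (isStable? d H) {xs = subsets h} S∈) , sym eq

-- Each copy contributes one embedding, whose code determines the embedding and with it the copy.
copies-≤ : {H : Graph h} {G : Graph n} {ys : List B} (R : (Fin h → Fin n) → B → Set) →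
           (∀ {φ} → IsEmbedding H G φ → ∃ λ y → y List.∈ ys × R φ y) →
           (∀ {φ ψ y} → R φ y → R ψ y → ∀ u → φ u ≡ ψ u) →
           copies H G ℕ.≤ length ys
copies-≤ {H = H} {G} R total functional = length-≤ (λ K y → ∃ λ φ → IsIso H K φ × R φ y)
  (Unique.filter⁺ (H ≅?_) (subgraphs-unique G))
  (λ K∈ → let (φ , iso) = proj₂ (∈-filter⁻ (H ≅?_) {xs = subgraphs G} K∈)
              (y , y∈ , r) = total (iso⇒embedding iso)
          in y , y∈ , φ , iso , r)
  (λ (φ , iso , r) (ψ , iso′ , r′) → ≅-unique iso iso′ (functional r r′))

-- Different embeddings may have the same image subgraph, so elements have to be told apart by the
-- vertex sets of their images.
≤-copies : {H : Graph h} {G : Graph n} {xs : List A} (f : A → Fin h → Fin n) → Unique xs →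
           (∀ {x} → x List.∈ xs → IsEmbedding H G (f x)) →
           (∀ {x y} → (∀ a → ∃ λ b → f y b ≡ f x a) → x ≡ y) →
           length xs ℕ.≤ copies H G
≤-copies {H = H} {G} f u emb distinct = length-≤ (λ x K → IsIso H K (f x)) u
  (λ x∈ → let K = imageSubgraph H G (emb x∈)
              iso = imageSubgraph-iso H G (emb x∈)
          in K , ∈-filter⁺ (H ≅?_) (∈-subgraphs K) (_ , iso) , iso)
  (λ i j → distinct λ a →
     Equivalence.to (IsIso.image j _) (Equivalence.from (IsIso.image i _) (a , refl)))

-- Counting codes with few entries of the first kind

length-cartesianProductWith : {C : Set} (f : A → B → C) (xs : List A) (ys : List B) →
                              length (cartesianProductWith f xs ys) ≡ length xs ℕ.* length ys
length-cartesianProductWith f []       ys = refl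
length-cartesianProductWith f (x ∷ xs) ys = trans (length-++ (map (f x) ys))
  (cong₂ ℕ._+_ (length-map (f x) ys) (length-cartesianProductWith f xs ys))

module _ (xs : List A) (ys : List B) where

  private
    inj₁-∷ : A → Vec (A ⊎ B) h → Vec (A ⊎ B) (suc h)
    inj₁-∷ x c = inj₁ x ∷ c

    inj₂-∷ : B → Vec (A ⊎ B) h → Vec (A ⊎ B) (suc h)
    inj₂-∷ y c = inj₂ y ∷ c

  -- Codes with at most a entries of the form inj₁.
  boundedCodes : (h a : ℕ) → List (Vec (A ⊎ B) h)
  boundedCodes zero    a       = [] ∷ []
  boundedCodes (suc h) zero    = cartesianProductWith inj₂-∷ ys (boundedCodes h zero)
  boundedCodes (suc h) (suc a) =
    cartesianProductWith inj₁-∷ xs (boundedCodes h a) ++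
    cartesianProductWith inj₂-∷ ys (boundedCodes h (suc a))

  -- With x and y the lengths of `xs` and `ys`, a first entry `inj₁` costs one unit of the budget
  -- and contributes x times x^a, while `inj₂` contributes y times x^(a+1); together they give the
  -- factor 1 + y. Budget left at the end is absorbed by 1 ≤ x^a.
  length-boundedCodes : length xs ≥ 1 → ∀ h a →
                        length (boundedCodes h a) ℕ.≤ suc (length ys) ^ h ℕ.* length xs ^ a
  length-boundedCodes nonempty zero a =
    ℕ.≤-trans (ℕ.m^n>0 (length xs) {{ℕ.>-nonZero nonempty}} a) (ℕ.≤-reflexive (sym (ℕ.*-identityˡ _)))
  length-boundedCodes nonempty (suc h) zero = begin
    length (boundedCodes (suc h) zero)                 ≡⟨ length-cartesianProductWith _ ys _ ⟩
    length ys ℕ.* length (boundedCodes h zero)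
      ≤⟨ ℕ.*-mono-≤ (ℕ.n≤1+n (length ys)) (length-boundedCodes nonempty h zero) ⟩
    suc (length ys) ℕ.* (suc (length ys) ^ h ℕ.* 1)    ≡⟨ ℕ.*-assoc (suc (length ys)) (suc (length ys) ^ h) 1 ⟨
    suc (length ys) ^ suc h ℕ.* 1                      ∎
    where open ℕ.≤-Reasoning
  length-boundedCodes nonempty (suc h) (suc a) = begin
    length (boundedCodes (suc h) (suc a))
      ≡⟨ length-++ (cartesianProductWith inj₁-∷ xs (boundedCodes h a)) ⟩
    _ ≡⟨ cong₂ ℕ._+_ (length-cartesianProductWith _ xs _) (length-cartesianProductWith _ ys _) ⟩
    x ℕ.* length (boundedCodes h a) ℕ.+ y ℕ.* length (boundedCodes h (suc a))
      ≤⟨ ℕ.+-mono-≤ (ℕ.*-monoʳ-≤ x (length-boundedCodes nonempty h a))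
                    (ℕ.*-monoʳ-≤ y (length-boundedCodes nonempty h (suc a))) ⟩
    x ℕ.* (suc y ^ h ℕ.* x ^ a) ℕ.+ y ℕ.* (suc y ^ h ℕ.* (x ℕ.* x ^ a))
      ≡⟨ solve 4 (λ x y p q → x :* (p :* q) :+ y :* (p :* (x :* q)) := (con 1 :+ y) :* p :* (x :* q)) refl
           x y (suc y ^ h) (x ^ a) ⟩
    suc y ^ suc h ℕ.* x ^ suc a ∎
    where
    open ℕ.≤-Reasoning
    open +-*-Solver
    x y : ℕ
    x = length xs
    y = length ys

  -- The set `S` may also contain positions of `inj₂` entries; the budget is then not exhausted.
  ∈-boundedCodes : (∀ x → x List.∈ xs) → (∀ y → y List.∈ ys) → ∀ {a} (c : Vec (A ⊎ B) h) (S : Subset h) →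
                   (∀ u {x} → lookup c u ≡ inj₁ x → u ∈ S) → ∣ S ∣ ℕ.≤ a → c List.∈ boundedCodes h a
  ∈-boundedCodes x∈ y∈ [] S inS le = here refl
  ∈-boundedCodes x∈ y∈ (inj₁ x ∷ c) (outside ∷ S) inS le = contradiction (inS zero refl) λ ()
  ∈-boundedCodes x∈ y∈ (inj₁ x ∷ c) (inside  ∷ S) inS (s≤s le) =
    ∈-++⁺ˡ (∈-cartesianProductWith⁺ inj₁-∷ (x∈ x) (∈-boundedCodes x∈ y∈ c S (λ u → drop-there ∘ inS (suc u)) le))
  ∈-boundedCodes x∈ y∈ {zero} (inj₂ y ∷ c) (s ∷ S) inS le = ∈-cartesianProductWith⁺ inj₂-∷ (y∈ y)
    (∈-boundedCodes x∈ y∈ c S (λ u → drop-there ∘ inS (suc u)) (ℕ.≤-trans (∣p∣≤∣x∷p∣ s S) le))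
  ∈-boundedCodes x∈ y∈ {suc a} (inj₂ y ∷ c) (s ∷ S) inS le =
    ∈-++⁺ʳ (cartesianProductWith inj₁-∷ xs (boundedCodes _ a)) (∈-cartesianProductWith⁺ inj₂-∷ (y∈ y)
      (∈-boundedCodes x∈ y∈ c S (λ u → drop-there ∘ inS (suc u)) (ℕ.≤-trans (∣p∣≤∣x∷p∣ s S) le)))

-- Elimination orders

later : Graph n → (Fin n → ℕ) → Fin n → Subset n
later G t v = comprehension λ u → adj? G v u ×-dec t v ℕ.<? t u

-- A sparse vertex `w` of `W` is removed at time 0, and the times obtained for `W - w` are shifted
-- by one. All neighbours of `w` in `W` number at most `d`, and every other vertex keeps its later
-- neighbours. The number `k` serves for the recursion; times outside `W` carry no meaning, hence
-- the intersections with `W`.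
eliminationOrder-on : {G : Graph n} → Degenerate d G → ∀ k (W : Subset n) → ∣ W ∣ ℕ.≤ k →
  ∃ λ (t : Fin n → ℕ) → (∀ {u v} → u ∈ W → v ∈ W → t u ≡ t v → u ≡ v) ×
                        (∀ {v} → v ∈ W → ∣ later G t v ∩ W ∣ ℕ.≤ d)
eliminationOrder-on {n} {d} {G} deg k W le with nonempty? W
eliminationOrder-on deg k       W le | no ¬ne =
  (λ _ → 0) , (λ u∈ → contradiction (_ , u∈) ¬ne) , λ v∈ → contradiction (_ , v∈) ¬ne
eliminationOrder-on deg zero    W le | yes (u , u∈) = contradiction (ℕ.<-≤-trans (x∈p⇒∣p-x∣<∣p∣ u∈) le) λ ()
eliminationOrder-on {n} {d} {G} deg (suc k) W le | yes ne
  with w , w∈ , few ← degenerate⇒sparse deg W ne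
  with t , inj , small ← eliminationOrder-on deg k (W - w) (ℕ.≤-pred (ℕ.<-≤-trans (x∈p⇒∣p-x∣<∣p∣ w∈) le)) =
    t′ , inj′ , small′
  where
  t′ : Fin n → ℕ
  t′ u with u ≟ w
  ... | yes _ = 0
  ... | no  _ = suc (t u)

  inj′ : ∀ {u v} → u ∈ W → v ∈ W → t′ u ≡ t′ v → u ≡ v
  inj′ {u} {v} u∈ v∈ eq with u ≟ w | v ≟ w
  ... | yes refl | yes refl = refl
  ... | no u≢w   | no v≢w   =
    inj (x∈p∧x≢y⇒x∈p-y u∈ u≢w) (x∈p∧x≢y⇒x∈p-y v∈ v≢w) (ℕ.suc-injective eq)

  later′⁻ : ∀ {v u} → v ≢ w → u ∈ later G t′ v → Adj G v u × t v ℕ.< t u × u ≢ w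
  later′⁻ {v} {u} v≢w u∈
    with ∈-comprehension⁻ (λ u → adj? G v u ×-dec t′ v ℕ.<? t′ u) u∈
  ... | e , lt with v ≟ w | u ≟ w
  ... | yes v≡w | _      = contradiction v≡w v≢w
  -- The case `u ≡ w` cannot arise, since time 0 is later than nothing.
  ... | no _    | no u≢w = e , ℕ.≤-pred lt , u≢w

  small′ : ∀ {v} → v ∈ W → ∣ later G t′ v ∩ W ∣ ℕ.≤ d
  small′ {v} v∈ = go (v ≟ w)
    where
    go : Dec (v ≡ w) → ∣ later G t′ v ∩ W ∣ ℕ.≤ d
    go (yes refl) = ℕ.≤-trans (p⊆q⇒∣p∣≤∣q∣ λ u∈ →
      let (x , y) = x∈p∩q⁻ (later G t′ v) W u∈
      in x∈p∩q⁺ (proj₁ (∈-comprehension⁻ (λ u → adj? G v u ×-dec t′ v ℕ.<? t′ u) x) , y)) few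
    go (no v≢w) = ℕ.≤-trans (p⊆q⇒∣p∣≤∣q∣ λ u∈ →
      let (x , y) = x∈p∩q⁻ (later G t′ v) W u∈
          (e , lt , u≢w) = later′⁻ v≢w x
      in x∈p∩q⁺ (∈-comprehension⁺ (λ u → adj? G v u ×-dec t v ℕ.<? t u) (e , lt) , x∈p∧x≢y⇒x∈p-y y u≢w))
      (small (x∈p∧x≢y⇒x∈p-y v∈ v≢w))

record EliminationOrder (d : ℕ) (G : Graph n) : Set where
  field
    time           : Fin n → ℕ
    time-injective : Injective _≡_ _≡_ time
    few-later      : ∀ v → ∣ later G time v ∣ ℕ.≤ d

  Later : Fin n → Fin n → Set
  Later v u = Adj G v u × time v ℕ.< time u

  later⁺ : ∀ {v u} → Later v u → u ∈ later G time v
  later⁺ {v} = ∈-comprehension⁺ (λ u → adj? G v u ×-dec time v ℕ.<? time u)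

eliminationOrder : {G : Graph n} → Degenerate d G → EliminationOrder d G
eliminationOrder {n} {d} {G} deg =
  let (t , inj , small) = eliminationOrder-on deg n ⊤ (∣p∣≤n ⊤)
  in record
    { time           = t
    ; time-injective = inj ∈⊤ ∈⊤
    ; few-later      = λ v → subst (λ p → ∣ p ∣ ℕ.≤ d) (∩-identityʳ (later G t v)) (small ∈⊤)
    }

-- Upper bound: coding embeddings

module _ {H : Graph h} {G : Graph n} (order : EliminationOrder d G) where
  open EliminationOrder order

  private
    Code : Set
    Code = Fin n ⊎ (Fin h × Fin d)

    labelOf : ∀ {v u} → Later v u → Fin d
    labelOf {v} l = label (later G time v) (few-later v) (later⁺ l)

    -- In the second case the entry gives the rank of `φ u` among the later neighbours of `φ w`, so
    -- it determines `φ u` only once `φ w` is known.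
    Encodes : (Fin h → Fin n) → Vec Code h → Set
    Encodes φ c = ∀ u → lookup c u ≡ inj₁ (φ u) ⊎
      (∃ λ w → ∃ λ (l : Later (φ w) (φ u)) → lookup c u ≡ inj₂ (w , labelOf l))

    -- The vertices `v` and `v′` are kept separate because the images they stand for are known to
    -- agree only by induction.
    label-determines : ∀ {v v′ u u′} (l : Later v u) (l′ : Later v′ u′) → v ≡ v′ → labelOf l ≡ labelOf l′ → u ≡ u′
    label-determines l l′ refl = label-injective _ _ (later⁺ l) (later⁺ l′)

    -- Induction on the removal time of `φ u`: the vertex named in the entry of `u` has an earlier
    -- image, on which both maps already agree.
    decode-unique : ∀ {φ ψ c} → Encodes φ c → Encodes ψ c → ∀ u → φ u ≡ ψ u
    decode-unique {φ} {ψ} {c} p q u = go u (<-wellFounded (time (φ u)))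
      where
      go : ∀ u → Acc ℕ._<_ (time (φ u)) → φ u ≡ ψ u
      go u (acc rs) with p u | q u
      ... | inj₁ e           | inj₁ e′            = inj₁-injective (trans (sym e) e′)
      ... | inj₁ e           | inj₂ (_ , _ , e′)  = contradiction (trans (sym e) e′) λ ()
      ... | inj₂ (_ , _ , e) | inj₁ e′            = contradiction (trans (sym e) e′) λ ()
      ... | inj₂ (w , l , e) | inj₂ (w′ , l′ , e′)
        -- Both entries come from the same code, so `w` and `w′` coincide and so do the labels.
        with refl , same ← ,-injective (inj₂-injective (trans (sym e) e′)) =
          label-determines l l′ (go w (rs (proj₂ l))) same

  module _ {φ : Fin h → Fin n} (emb : IsEmbedding H G φ) where
    open IsEmbedding emb

    private
      parent? : ∀ u → Dec (∃ λ w → Adj H w u × time (φ w) ℕ.< time (φ u))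
      parent? u = any? λ w → adj? H w u ×-dec time (φ w) ℕ.<? time (φ u)

      sources : Subset h
      sources = comprehension (¬? ∘ parent?)

      sources-before : ∀ {u w} → u ∈ sources → Adj H u w → time (φ u) ℕ.< time (φ w)
      sources-before {u} {w} u∈ uw with ℕ.<-cmp (time (φ u)) (time (φ w))
      ... | tri< lt _ _ = lt
      ... | tri≈ _ eq _ = contradiction (subst (Adj H u) (sym (injective (time-injective eq))) uw) (Adj-irrefl H)
      ... | tri> _ _ gt = contradiction (w , Adj-sym H uw , gt) (∈-comprehension⁻ (¬? ∘ parent?) u∈)

      -- Of two adjacent sources each would precede the other. All neighbours of a source `u` are
      -- mapped to later neighbours of `φ u`, of which there are at most `d`.
      sources-stable : IsStable d H sources
      sources-stable =
        (λ u v u∈ v∈ uv → ℕ.<-asym (sources-before u∈ uv) (sources-before v∈ (Adj-sym H uv))) ,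
        (λ u u∈ → ℕ.≤-trans
          (∣p∣≤∣q∣-injection (neighbours H u) (later G time (φ u)) φ
            (λ uw → later⁺ (adjacency uw , sources-before u∈ uw)) (λ _ _ → injective))
          (few-later (φ u)))

      codeOf : Fin h → Code
      codeOf u with parent? u
      ... | yes (w , wu , lt) = inj₂ (w , labelOf (adjacency wu , lt))
      ... | no _              = inj₁ (φ u)

      -- Entries that give an image outright sit at sources, so `α d H` limits their number.
      codeOf-source : ∀ u {x} → codeOf u ≡ inj₁ x → u ∈ sources
      codeOf-source u eq with parent? u
      ... | no ¬p = ∈-comprehension⁺ (¬? ∘ parent?) ¬p

      codeOf-encodes : ∀ u → codeOf u ≡ inj₁ (φ u) ⊎
        (∃ λ w → ∃ λ (l : Later (φ w) (φ u)) → codeOf u ≡ inj₂ (w , labelOf l))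
      codeOf-encodes u with parent? u
      ... | yes (w , wu , lt) = inj₂ (w , (adjacency wu , lt) , refl)
      ... | no _              = inj₁ refl

    embedding-code :
      ∃ λ c → c List.∈ boundedCodes (allFin n) (cartesianProduct (allFin h) (allFin d)) h (α d H) × Encodes φ c
    embedding-code = tabulate codeOf ,
      ∈-boundedCodes _ _ ∈-allFin (λ (w , i) → ∈-cartesianProduct⁺ (∈-allFin w) (∈-allFin i))
        (tabulate codeOf) sources
        (λ u eq → codeOf-source u (trans (sym (lookup∘tabulate codeOf u)) eq))
        (stable≤α {H = H} sources-stable) ,
      λ u → subst (λ y → y ≡ inj₁ (φ u) ⊎ (∃ λ w → ∃ λ (l : Later (φ w) (φ u)) → y ≡ inj₂ (w , labelOf l)))
              (sym (lookup∘tabulate codeOf u)) (codeOf-encodes u)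

  copies-order-≤ : n ≥ 1 → copies H G ℕ.≤ suc (h ℕ.* d) ^ h ℕ.* n ^ α d H
  copies-order-≤ n≥1 = begin
    copies H G ≤⟨ copies-≤ {H = H} Encodes embedding-code (λ {φ} {ψ} {c} → decode-unique {φ} {ψ} {c}) ⟩
    length (boundedCodes vs ls h (α d H))
      ≤⟨ length-boundedCodes vs ls (subst (ℕ._≥ 1) (sym (length-tabulate id)) n≥1) h (α d H) ⟩
    suc (length ls) ^ h ℕ.* length vs ^ α d H
      ≡⟨ cong₂ (λ x y → suc x ^ h ℕ.* y ^ α d H)
           (trans (length-cartesianProductWith _,_ (allFin h) (allFin d))
             (cong₂ ℕ._*_ (length-tabulate {n = h} id) (length-tabulate {n = d} id)))
           (length-tabulate {n = n} id) ⟩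
    suc (h ℕ.* d) ^ h ℕ.* n ^ α d H ∎
    where
    open ℕ.≤-Reasoning
    vs = allFin n
    ls = cartesianProduct (allFin h) (allFin d)

ex-upper : (H : Graph h) → n ≥ 1 → ex H (𝒟 d) n ℕ.≤ suc (h ℕ.* d) ^ h ℕ.* n ^ α d H
ex-upper H n≥1 = ex-≤ H _ λ deg → copies-order-≤ {H = H} (eliminationOrder deg) n≥1

-- Lower bound: choosing one copy of each vertex

-- Each vertex of `S` may use any of `suc m` copies, every other vertex only copy 0.
supportedVectors : (m : ℕ) → Subset h → List (Vec (Fin (suc m)) h)
supportedVectors m []            = [] ∷ []
supportedVectors m (inside  ∷ S) = cartesianProductWith _∷_ (allFin (suc m)) (supportedVectors m S)
supportedVectors m (outside ∷ S) = map (zero ∷_) (supportedVectors m S)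

supportedVectors-unique : ∀ m (S : Subset h) → Unique (supportedVectors m S)
supportedVectors-unique m []            = [] ∷ []
supportedVectors-unique m (inside  ∷ S) =
  Unique.cartesianProductWith⁺ _∷_ ∷-injective (Unique.allFin⁺ (suc m)) (supportedVectors-unique m S)
supportedVectors-unique m (outside ∷ S) = Unique.map⁺ ∷-injectiveʳ (supportedVectors-unique m S)

length-supportedVectors : ∀ m (S : Subset h) → length (supportedVectors m S) ≡ suc m ^ ∣ S ∣
length-supportedVectors m []            = refl
length-supportedVectors m (inside  ∷ S) = trans
  (length-cartesianProductWith _∷_ (allFin (suc m)) (supportedVectors m S))
  (cong₂ ℕ._*_ (length-tabulate {n = suc m} id) (length-supportedVectors m S))
length-supportedVectors m (outside ∷ S) =
  trans (length-map (zero ∷_) (supportedVectors m S)) (length-supportedVectors m S)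

supportedVectors-zero : ∀ (S : Subset h) {κ} → κ List.∈ supportedVectors m S → ∀ {a} → a ∉ S → lookup κ a ≡ zero
supportedVectors-zero {m = m} (inside ∷ S) κ∈ {a} a∉
  with ∈-cartesianProductWith⁻ _∷_ (allFin (suc m)) (supportedVectors m S) κ∈ | a
... | _ , _ , _ , _   , refl | zero  = contradiction here a∉
... | _ , _ , _ , κ′∈ , refl | suc _ = supportedVectors-zero S κ′∈ (a∉ ∘ there)
supportedVectors-zero (outside ∷ S) κ∈ {a} a∉ with ∈-map⁻ (zero ∷_) κ∈ | a
... | _ , _   , refl | zero  = refl
... | _ , κ′∈ , refl | suc _ = supportedVectors-zero S κ′∈ (a∉ ∘ there)

-- Blowing up a stable set

module BlowUp (H : Graph h) {S : Subset h} (stable : IsStable d H S) (m r : ℕ) where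

  size : ℕ
  size = h ℕ.* suc m ℕ.+ r

  vertex : Fin h → Fin (suc m) → Fin size
  vertex a k = combine a k ↑ˡ r

  vertex-injective : ∀ {a b k l} → vertex a k ≡ vertex b l → a ≡ b × k ≡ l
  vertex-injective {a} {b} {k} {l} eq = combine-injective a k b l (↑ˡ-injective r _ _ eq)

  -- A vertex outside S keeps only its copy 0; its other copies and the last r vertices are isolated padding.
  CopyOf : Fin size → Fin h → Set
  CopyOf v a = ∃ λ k → vertex a k ≡ v × (a ∈ S ⊎ k ≡ zero)

  copyOf? : ∀ v a → Dec (CopyOf v a)
  copyOf? v a = any? λ k → vertex a k ≟ v ×-dec (a ∈? S ⊎-dec k ≟ zero)

  copyOf-functional : ∀ {v a b} → CopyOf v a → CopyOf v b → a ≡ b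
  copyOf-functional (_ , p , _) (_ , q , _) = proj₁ (vertex-injective (trans p (sym q)))

  copyOf-injective : ∀ {v w a} → a ∉ S → CopyOf v a → CopyOf w a → v ≡ w
  copyOf-injective a∉ (_ , _    , inj₁ a∈)   _                        = contradiction a∈ a∉
  copyOf-injective a∉ (_ , _    , inj₂ _)    (_ , _    , inj₁ a∈)   = contradiction a∈ a∉
  copyOf-injective a∉ (_ , refl , inj₂ refl) (_ , refl , inj₂ refl) = refl

  -- The default is a parameter because `Fin h` may be empty.
  original : Fin h → Fin size → Fin h
  original default v with any? (copyOf? v)
  ... | yes (a , _) = a
  ... | no _        = default

  original-correct : ∀ {c v a} → CopyOf v a → original c v ≡ a
  original-correct {v = v} p with any? (copyOf? v)
  ... | yes (_ , q) = copyOf-functional q p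
  ... | no ¬q       = contradiction (_ , p) ¬q

  Edge : Fin size → Fin size → Set
  Edge v w = ∃ λ a → ∃ λ b → CopyOf v a × CopyOf w b × Adj H a b

  edge? : ∀ v w → Dec (Edge v w)
  edge? v w = any? λ a → any? λ b → copyOf? v a ×-dec copyOf? w b ×-dec adj? H a b

  blowUp : Graph size
  blowUp = relationGraph edge?
    (λ (a , b , p , q , e) → b , a , q , p , Adj-sym H e)
    (λ (a , b , p , q , e) → Adj-irrefl H (subst (Adj H a) (copyOf-functional q p) e))

  edge-original : ∀ {c v w} → Adj blowUp v w → Adj H (original c v) (original c w)
  edge-original vw with a , b , p , q , ab ← ∈-rows⁻ edge? vw =
    subst₂ (Adj H) (sym (original-correct p)) (sym (original-correct q)) ab

  -- The core carries a single copy of `H` with `S` deleted.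
  Core : Fin size → Set
  Core v = ∃ λ a → a ∉ S × CopyOf v a

  core? : ∀ v → Dec (Core v)
  core? v = any? λ a → ¬? (a ∈? S) ×-dec copyOf? v a

  core-injective : ∀ {c v w} → Core v → Core w → original c v ≡ original c w → v ≡ w
  core-injective {c} {v} {w} (a , a∉ , p) (b , b∉ , q) eq = copyOf-injective a∉ p
    (subst (CopyOf w) (trans (sym (original-correct q)) (trans (sym eq) (original-correct p))) q)

  -- A vertex that is no copy is isolated. For a copy of `a` in `S`, stability puts all neighbours
  -- into the core, where `original` injects them into the at most `d` neighbours of `a`.
  nonCore-degree : ∀ {v} → ¬ Core v → degree blowUp v ℕ.≤ d
  nonCore-degree {v} ¬core with any? (copyOf? v)
  ... | no ¬copy = ℕ.≤-trans
    (p⊆q⇒∣p∣≤∣q∣ {q = ⊥} λ vw → let (a , _ , p , _) = ∈-rows⁻ edge? vw in contradiction (a , p) ¬copy)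
    (subst (ℕ._≤ d) (sym (∣⊥∣≡0 size)) z≤n)
  ... | yes (a , p) with a ∈? S
  ...   | no a∉  = contradiction (a , a∉ , p) ¬core
  ...   | yes a∈ = ℕ.≤-trans
    (∣p∣≤∣q∣-injection (neighbours blowUp v) (neighbours H a) (original a)
      (λ vw → let (a′ , b , p′ , q , ab) = ∈-rows⁻ edge? vw
              in subst₂ (Adj H) (copyOf-functional p′ p) (sym (original-correct q)) ab)
      (λ vw vw′ → core-injective (neighbour-core vw) (neighbour-core vw′)))
    (proj₂ stable a a∈)
    where
    neighbour-core : ∀ {w} → Adj blowUp v w → Core w
    neighbour-core vw with a′ , b , p′ , q , ab ← ∈-rows⁻ edge? vw
      with refl ← copyOf-functional p p′ = b , (λ b∈ → proj₁ stable a b a∈ b∈ ab) , q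

  -- A set that leaves the core contains a vertex of degree at most `d`; a set inside the core is
  -- projected injectively to `H`, whose degeneracy applies.
  blowUp-degenerate : Degenerate d H → Degenerate d blowUp
  blowUp-degenerate deg = sparse⇒degenerate sparse
    where
    sparse : ∀ W → Nonempty W → SparseVertex d blowUp W
    sparse W ne@(u , u∈) with any? (λ v → v ∈? W ×-dec ¬? (core? v))
    ... | yes (v , v∈ , ¬core) =
      v , v∈ , ℕ.≤-trans (∣p∩q∣≤∣p∣ (neighbours blowUp v) W) (nonCore-degree ¬core)
    ... | no ¬exists = sparseVertex-pullback {H = blowUp} deg W ne (original (proj₁ (core u∈)))
      (λ v∈ w∈ → core-injective (core v∈) (core w∈))
      (λ _ _ → edge-original)
      where
      core : ∀ {v} → v ∈ W → Core v
      core {v} v∈ with core? v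
      ... | yes c = c
      ... | no ¬c = contradiction (v , v∈ , ¬c) ¬exists

  transversal : Vec (Fin (suc m)) h → Fin h → Fin size
  transversal κ a = vertex a (lookup κ a)

  transversal-embedding : ∀ {κ} → κ List.∈ supportedVectors m S → IsEmbedding H blowUp (transversal κ)
  transversal-embedding {κ} κ∈ = record
    { injective = proj₁ ∘ vertex-injective
    ; adjacency = λ {a} {b} ab → ∈-rows⁺ edge? (a , b , copy a , copy b , ab)
    }
    where
    copy : ∀ a → CopyOf (transversal κ a) a
    copy a with a ∈? S
    ... | yes a∈ = lookup κ a , refl , inj₁ a∈
    ... | no  a∉ = lookup κ a , refl , inj₂ (supportedVectors-zero S κ∈ a∉)

  -- A copy of `a` in the other image can only be the one chosen there for `a`.
  transversal-distinct : ∀ {κ μ} → (∀ a → ∃ λ b → transversal μ b ≡ transversal κ a) → κ ≡ μ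
  transversal-distinct {κ} {μ} same =
    trans (sym (tabulate∘lookup κ)) (trans (tabulate-cong agree) (tabulate∘lookup μ))
    where
    agree : ∀ a → lookup κ a ≡ lookup μ a
    agree a with b , eq ← same a with refl , eq′ ← vertex-injective eq = sym eq′

  copies-blowUp : suc m ^ ∣ S ∣ ℕ.≤ copies H blowUp
  copies-blowUp = subst (ℕ._≤ copies H blowUp) (length-supportedVectors m S)
    (≤-copies {H = H} transversal (supportedVectors-unique m S) transversal-embedding transversal-distinct)

ex-lower-blowUp : {H : Graph h} → Degenerate d H → ∀ q .{{_ : ℕ.NonZero q}} r →
                  q ^ α d H ℕ.≤ ex H (𝒟 d) (h ℕ.* q ℕ.+ r)
ex-lower-blowUp {H = H} deg (suc m) r with S , stable , eq ← α-attained H =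
  subst (λ s → suc m ^ s ℕ.≤ _) eq (ℕ.≤-trans copies-blowUp (copies≤ex H (blowUp-degenerate deg)))
  where open BlowUp H stable m r

-- From blow-ups to every large order

^-distribʳ-* : ∀ k m n → (m ℕ.* n) ^ k ≡ m ^ k ℕ.* n ^ k
^-distribʳ-* zero    m n = refl
^-distribʳ-* (suc k) m n = trans (cong (m ℕ.* n ℕ.*_) (^-distribʳ-* k m n))
  (ℕ.[m*n]*[o*p]≡[m*o]*[n*p] m n (m ^ k) (n ^ k))

-- The quotient is positive, so the remainder is at most one more multiple of `s` by the quotient.
n≤2*s*[n/s] : ∀ {n} s .{{_ : ℕ.NonZero s}} → n ≥ s → n ℕ.≤ 2 ℕ.* s ℕ.* (n ℕ./ s)
n≤2*s*[n/s] {n} s n≥s = begin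
  n                              ≡⟨ ℕ.m≡m%n+[m/n]*n n s ⟩
  n ℕ.% s ℕ.+ q ℕ.* s            ≤⟨ ℕ.+-mono-≤ (ℕ.<⇒≤ (ℕ.m%n<n n s)) ℕ.≤-refl ⟩
  s ℕ.+ q ℕ.* s                  ≤⟨ ℕ.+-monoˡ-≤ (q ℕ.* s) (ℕ.m≤n*m s q {{ℕ.>-nonZero (ℕ.m≥n⇒m/n>0 n≥s)}}) ⟩
  q ℕ.* s ℕ.+ q ℕ.* s            ≡⟨ solve 2 (λ q s → q :* s :+ q :* s := con 2 :* s :* q) refl q s ⟩
  2 ℕ.* s ℕ.* q                  ∎
  where
  open ℕ.≤-Reasoning
  open +-*-Solver
  q : ℕ
  q = n ℕ./ s

ex-lower : {H : Graph h} → Degenerate d H → n ≥ suc h →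
           n ^ α d H ℕ.≤ (2 ℕ.* suc h) ^ α d H ℕ.* ex H (𝒟 d) n
ex-lower {h} {d} {n} {H} deg n≥1+h = begin
  n ^ α d H                                ≤⟨ ℕ.^-monoˡ-≤ (α d H) (n≤2*s*[n/s] (suc h) n≥1+h) ⟩
  (2 ℕ.* suc h ℕ.* q) ^ α d H              ≡⟨ ^-distribʳ-* (α d H) (2 ℕ.* suc h) q ⟩
  (2 ℕ.* suc h) ^ α d H ℕ.* q ^ α d H      ≤⟨ ℕ.*-monoʳ-≤ ((2 ℕ.* suc h) ^ α d H) q^α≤ex ⟩
  (2 ℕ.* suc h) ^ α d H ℕ.* ex H (𝒟 d) n   ∎
  where
  open ℕ.≤-Reasoning

  q : ℕ
  -- The divisor is `suc h` so that it is nonzero even when `H` has no vertices; the `n ∸ h * q`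
  -- remaining vertices become padding.
  q = n ℕ./ suc h

  hq≤n : h ℕ.* q ℕ.≤ n
  hq≤n = ℕ.≤-trans (ℕ.*-monoˡ-≤ q (ℕ.n≤1+n h)) (subst (ℕ._≤ n) (ℕ.*-comm q (suc h)) (ℕ.m/n*n≤m n (suc h)))

  q^α≤ex : q ^ α d H ℕ.≤ ex H (𝒟 d) n
  q^α≤ex = subst (λ k → q ^ α d H ℕ.≤ ex H (𝒟 d) k) (ℕ.m+[n∸m]≡n hq≤n)
    (ex-lower-blowUp deg q {{ℕ.>-nonZero (ℕ.m≥n⇒m/n>0 n≥1+h)}} (n ℕ.∸ h ℕ.* q))

-- Passing to rational numbers

-- Normalisation involves a gcd that does not compute for a variable `m`, so the arithmetic is done
-- with unnormalised fractions.
fromℕ-≃ : ∀ m → toℚᵘ (fromℕ m) ≃ mkℚᵘ (ℤ.+ m) 0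
fromℕ-≃ m = ℚ.toℚᵘ-fromℚᵘ (mkℚᵘ (ℤ.+ m) 0)

fromℕ-mono-≤ : ∀ {m n} → m ℕ.≤ n → fromℕ m ≤ fromℕ n
fromℕ-mono-≤ {m} {n} m≤n = ℚ.toℚᵘ-cancel-≤ (begin
  toℚᵘ (fromℕ m)    ≃⟨ fromℕ-≃ m ⟩
  mkℚᵘ (ℤ.+ m) 0    ≤⟨ *≤* (ℤ.*-monoʳ-≤-nonNeg (ℤ.+ 1) (ℤ.+≤+ m≤n)) ⟩
  mkℚᵘ (ℤ.+ n) 0    ≃⟨ fromℕ-≃ n ⟨
  toℚᵘ (fromℕ n)    ∎)
  where open ℚᵘ.≤-Reasoning

fromℕ-* : ∀ m n → fromℕ (m ℕ.* n) ≡ fromℕ m * fromℕ n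
fromℕ-* m n = ℚ.toℚᵘ-injective (begin-equality
  toℚᵘ (fromℕ (m ℕ.* n))                    ≃⟨ fromℕ-≃ (m ℕ.* n) ⟩
  mkℚᵘ (ℤ.+ (m ℕ.* n)) 0                    ≡⟨ cong (λ z → mkℚᵘ z 0) (ℤ.pos-* m n) ⟩
  mkℚᵘ (ℤ.+ m) 0 ℚᵘ.* mkℚᵘ (ℤ.+ n) 0        ≃⟨ ℚᵘ.*-cong (fromℕ-≃ m) (fromℕ-≃ n) ⟨
  toℚᵘ (fromℕ m) ℚᵘ.* toℚᵘ (fromℕ n)        ≃⟨ ℚ.toℚᵘ-homo-* (fromℕ m) (fromℕ n) ⟨
  toℚᵘ (fromℕ m * fromℕ n)                  ∎)
  where open ℚᵘ.≤-Reasoning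

fromℕ-positive : ∀ m .{{_ : ℕ.NonZero m}} → Positive (fromℕ m)
fromℕ-positive m = ℚ.normalize-pos m 1

mainTheorem6 : (d : ℕ) {h : ℕ} (H : Graph h) →
    (¬ Degenerate d H → ∀ n → ex H (𝒟 d) n ≡ 0) ×
    (Degenerate d H → ∃ λ (c₁ : ℚ) → ∃ λ (c₂ : ℚ) → 0ℚ < c₁ × 0ℚ < c₂ ×
    (∀ n → n ≥ 1 → fromℕ (ex H (𝒟 d) n) ≤ c₂ * fromℕ (n ^ α d H)) ×
    (∃ λ n₀ → ∀ n → n ≥ n₀ → c₁ * fromℕ (n ^ α d H) ≤ fromℕ (ex H (𝒟 d) n)))
mainTheorem6 d {h} H = vanishing , λ deg →
  1/ fromℕ D , fromℕ C , ℚ.positive⁻¹ (1/ fromℕ D) , ℚ.positive⁻¹ (fromℕ C) ,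
  upper , suc h , lower deg
  where
  C D : ℕ
  -- `C` is the factor from counting codes; `D` is the loss from replacing `n` by the quotient of
  -- `n` by `suc h`.
  C = suc (h ℕ.* d) ^ h
  D = (2 ℕ.* suc h) ^ α d H

  instance
    C-positive : Positive (fromℕ C)
    C-positive = fromℕ-positive C {{ℕ.m^n≢0 (suc (h ℕ.* d)) h}}

    D-positive : Positive (fromℕ D)
    D-positive = fromℕ-positive D {{ℕ.m^n≢0 (2 ℕ.* suc h) (α d H)}}

    D-nonZero : NonZero (fromℕ D)
    D-nonZero = ℚ.pos⇒nonZero (fromℕ D)

    1/D-positive : Positive (1/ fromℕ D)
    1/D-positive = ℚ.1/pos⇒pos (fromℕ D)

    1/D-nonNegative : NonNegative (1/ fromℕ D)
    1/D-nonNegative = ℚ.pos⇒nonNeg (1/ fromℕ D)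

  vanishing : ¬ Degenerate d H → ∀ n → ex H (𝒟 d) n ≡ 0
  vanishing ¬deg n = ℕ.n≤0⇒n≡0 (ex-≤ {n = n} H 0 λ deg →
    -- A single embedding would make `H` degenerate, so an empty list of codes suffices.
    copies-≤ {ys = []} (λ _ (_ : Empty.⊥) → Empty.⊥)
      (λ emb → contradiction (embedding⇒degenerate emb deg) ¬deg) (λ ()))

  upper : ∀ n → n ≥ 1 → fromℕ (ex H (𝒟 d) n) ≤ fromℕ C * fromℕ (n ^ α d H)
  upper n n≥1 = ℚ.≤-trans (fromℕ-mono-≤ (ex-upper H n≥1)) (ℚ.≤-reflexive (fromℕ-* C (n ^ α d H)))

  lower : Degenerate d H → ∀ n → n ≥ suc h → 1/ fromℕ D * fromℕ (n ^ α d H) ≤ fromℕ (ex H (𝒟 d) n)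
  lower deg n n≥1+h = begin
    1/ fromℕ D * fromℕ (n ^ α d H)
      ≤⟨ ℚ.*-monoˡ-≤-nonNeg (1/ fromℕ D) (fromℕ-mono-≤ (ex-lower deg n≥1+h)) ⟩
    1/ fromℕ D * fromℕ (D ℕ.* ex H (𝒟 d) n)         ≡⟨ cong (1/ fromℕ D *_) (fromℕ-* D (ex H (𝒟 d) n)) ⟩
    1/ fromℕ D * (fromℕ D * fromℕ (ex H (𝒟 d) n))   ≡⟨ ℚ.*-assoc (1/ fromℕ D) (fromℕ D) _ ⟨
    1/ fromℕ D * fromℕ D * fromℕ (ex H (𝒟 d) n)     ≡⟨ cong (_* fromℕ (ex H (𝒟 d) n)) (ℚ.*-inverseˡ (fromℕ D)) ⟩
    1ℚ * fromℕ (ex H (𝒟 d) n)                       ≡⟨ ℚ.*-identityˡ _ ⟩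
    fromℕ (ex H (𝒟 d) n)                            ∎
    where open ℚ.≤-Reasoning
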